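{- Let $H = (V, A, B)$ be a critical cross-intersecting family, and let $n := \max_{e \in A \cup B} |e|$ be the (finite) maximum size of an edge. Then $\max(|A|, |B|) \leq n^n$.
   Context: A hypergraph is a pair $(V,E)$ where $V$ is a set of vertices and $E$ is a set of subsets of $V$ (edges). A cross-intersecting family $H = (V, A, B)$ is a hypergraph with vertex set $V$ and edge set $A \cup B$, where $A$ and $B$ are non-empty (not necessarily disjoint) sets of edges such that $a \cap b \neq \emptyset$ for every $a \in A$ and $b \in B$. A cross-intersecting family $(V,A,B)$ is called critical if (i) for any edge $a \in A$ and any $v \in a$ there is $b \in B$ such that $a \cap b = \{v\}$, and (ii) for any edge $b \in B$ and any $v \in b$ there is $a \in A$ such that $a \cap b = \{v\}$. -}

module Defs where

open import Axiom.ExcludedMiddle using (ExcludedMiddle)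
open import Data.Empty using (⊥-elim)
open import Data.Fin.Base using (zero; suc)
open import Data.Fin.Properties using (injective⇒≤)
open import Data.List.Base using ([]; _∷_; length; lookup)
open import Data.List.Membership.Propositional.Properties using (∈-lookup)
open import Data.List.Relation.Unary.All as All using (All; []; _∷_)
open import Data.List.Relation.Unary.All.Properties using (¬Any⇒All¬)
open import Data.List.Relation.Unary.AllPairs using ([]; _∷_)
open import Data.List.Relation.Unary.Any using (index)
open import Data.Nat.Base using (ℕ; zero; suc; _+_; _≤_)
open import Data.Nat.Properties using (≤-trans; +-suc; +-identityʳ; 1+n≰n)
open import Data.Product.Base using (∃-syntax; _×_; _,_)
open import Level using (Level; _⊔_) renaming (suc to lsuc)
open import Relation.Binary.Bundles using (Setoid)
open import Relation.Binary.PropositionalEquality using (_≡_; refl; sym; trans; cong; subst; setoid)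
open import Relation.Nullary.Decidable.Core using (yes; no)
open import Relation.Unary using (Pred; _∈_; _∩_; _∪_; _≐_; _≬_; ｛_｝; Satisfiable)
open import Relation.Unary.Relation.Binary.Equality using (≐-setoid)

module Cardinality {c ℓ : Level} (S : Setoid c ℓ) where

  open Setoid S using (Carrier; _≈_)
    renaming (sym to ≈-sym)
  open import Data.List.Membership.Setoid S using () renaming (_∈_ to _∈ₗ_; _∉_ to _∉ₗ_)
  open import Data.List.Membership.Setoid.Properties using (index-injective)
  open import Data.List.Relation.Unary.Unique.Setoid S using (Unique)

  -- |P| = k.
  HasSize : {p : Level} → Pred Carrier p → ℕ → Set (c ⊔ ℓ ⊔ p)
  HasSize P k =
    ∃[ xs ] Unique xs × All P xs × (∀ {x} → x ∈ P → x ∈ₗ xs) × length xs ≡ k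

  -- |P| ≤ k for a P not assumed finite. A list of all members of P would
  -- amount to deciding membership and equality; bounding the number of distinct
  -- members does not. The three lemmas below compare this with HasSize:
  -- classically, AtMost P k holds iff HasSize P m for some m ≤ k.
  AtMost : {p : Level} → Pred Carrier p → ℕ → Set (c ⊔ ℓ ⊔ p)
  AtMost P k = ∀ xs → Unique xs → All P xs → length xs ≤ k

  private
    lookup-injective : ∀ {xs} → Unique xs → ∀ i j → lookup xs i ≈ lookup xs j → i ≡ j
    lookup-injective (_  ∷ _) zero    zero    _  = refl
    lookup-injective (x≉ ∷ _) zero    (suc j) eq = ⊥-elim (All.lookup x≉ (∈-lookup j) eq)
    lookup-injective (x≉ ∷ _) (suc i) zero    eq = ⊥-elim (All.lookup x≉ (∈-lookup i) (≈-sym eq))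
    lookup-injective (_  ∷ u) (suc i) (suc j) eq = cong suc (lookup-injective u i j eq)

  atMost⇒size≤ : ∀ {p} {P : Pred Carrier p} {k m} → HasSize P m → AtMost P k → m ≤ k
  atMost⇒size≤ (xs , u , ps , _ , refl) atMost = atMost xs u ps

  hasSize⇒atMost : ∀ {p} {P : Pred Carrier p} {k m} → HasSize P m → m ≤ k → AtMost P k
  hasSize⇒atMost (xs , _ , _ , complete , refl) m≤k ys u ps = ≤-trans (injective⇒≤ inj) m≤k
    where
    member : ∀ i → lookup ys i ∈ₗ xs
    member i = complete (All.lookup ps (∈-lookup i))

    inj : ∀ {i j} → index (member i) ≡ index (member j) → i ≡ j
    inj {i} {j} eq = lookup-injective u i j (index-injective S (member i) (member j) eq)

  atMost⇒hasSize : ∀ {p} {P : Pred Carrier p} {k} → ExcludedMiddle (c ⊔ ℓ ⊔ p) →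
                   AtMost P k → ∃[ m ] HasSize P m
  atMost⇒hasSize {p} {P} {k} em atMost = grow k [] refl [] []
    where
    grow : ∀ fuel xs → length xs + fuel ≡ k → Unique xs → All P xs → ∃[ m ] HasSize P m
    grow fuel xs eq u ps with em {∃[ x ] P x × x ∉ₗ xs}
    grow zero xs eq u ps | yes (x , px , x∉xs) =
      ⊥-elim (1+n≰n (subst (suc (length xs) ≤_) (trans (sym eq) (+-identityʳ _))
        (atMost (x ∷ xs) (¬Any⇒All¬ xs x∉xs ∷ u) (px ∷ ps))))
    grow (suc fuel) xs eq u ps | yes (x , px , x∉xs) =
      grow fuel (x ∷ xs) (trans (sym (+-suc _ fuel)) eq) (¬Any⇒All¬ xs x∉xs ∷ u) (px ∷ ps)
    grow fuel xs eq u ps | no ¬new = length xs , xs , u , ps , complete , refl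
      where
      complete : ∀ {x} → x ∈ P → x ∈ₗ xs
      complete {x} px with em {P x × x ∈ₗ xs}
      ... | yes (_ , x∈xs) = x∈xs
      ... | no ¬both = ⊥-elim (¬new (x , px , λ x∈xs → ¬both (px , x∈xs)))

Edge : {v : Level} (ℓ : Level) → Set v → Set (v ⊔ lsuc ℓ)
Edge ℓ V = Pred V ℓ

module EdgeCardinality {v : Level} (V : Set v) = Cardinality (setoid V)

-- Edges are counted up to extensional equality of subsets.
module FamilyCardinality {v : Level} (V : Set v) (ℓ : Level) = Cardinality (≐-setoid V ℓ)

record CrossIntersectingFamily {v : Level} (V : Set v) (ℓ ℓ′ : Level)
       : Set (v ⊔ lsuc ℓ ⊔ lsuc ℓ′) where
  field
    A B                : Pred (Edge ℓ V) ℓ′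
    A-nonempty         : Satisfiable A
    B-nonempty         : Satisfiable B
    cross-intersecting : ∀ {a b} → a ∈ A → b ∈ B → a ≬ b

module _ {v ℓ ℓ′ : Level} {V : Set v} (H : CrossIntersectingFamily V ℓ ℓ′) where

  open CrossIntersectingFamily H
  open EdgeCardinality V using (HasSize)

  record Critical : Set (v ⊔ lsuc ℓ ⊔ ℓ′) where
    field
      critical-A : ∀ {a} → a ∈ A → ∀ {x} → x ∈ a → ∃[ b ] b ∈ B × (a ∩ b) ≐ ｛ x ｝
      critical-B : ∀ {b} → b ∈ B → ∀ {x} → x ∈ b → ∃[ a ] a ∈ A × (a ∩ b) ≐ ｛ x ｝

  -- n is the maximum of |e| over e ∈ A ∪ B; in particular every edge is finite.
  record IsMaxEdgeSize (n : ℕ) : Set (v ⊔ lsuc ℓ ⊔ ℓ′) where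
    field
      bounded  : ∀ {e} → e ∈ (A ∪ B) → ∃[ k ] HasSize e k × k ≤ n
      attained : ∃[ e ] e ∈ (A ∪ B) × HasSize e n

{-# OPTIONS --safe #-}
-- Every edge of A is a minimal transversal of B. Grow a partial transversal S:
-- an edge b ∈ B missed by S is met by every a ⊇ S in one of the at most n
-- vertices of b, all outside S, so the members of A containing S split into at
-- most n classes, each containing a set larger by one vertex. The branching
-- stops when S meets all of B, since then minimality leaves only a = S, and
-- this happens within n steps because |a| ≤ n.
-- No equality or membership is decidable here, but the bound is a decidable
-- inequality between naturals, so the case distinctions may be made under ¬¬.
module Submission where

open import Defs
open import Data.Empty using (⊥-elim)
open import Data.List.Base using (List; []; _∷_; length)
open import Data.List.Relation.Unary.All as All using (All; []; _∷_)
open import Data.List.Relation.Unary.AllPairs using (AllPairs; []; _∷_)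
open import Data.List.Relation.Unary.Any as Any using (Any; here; there)
open import Data.List.Relation.Binary.Sublist.Propositional using (_⊆_; []; _∷_; _∷ʳ_)
open import Data.List.Relation.Binary.Sublist.Propositional.Properties using (All-resp-⊆)
open import Data.Nat.Base using (ℕ; zero; suc; _+_; _*_; _^_; _≤_; z≤n)
open import Data.Nat.Properties using (≤-refl; ≤-reflexive; ≤-trans; _≤?_; +-mono-≤; *-monoˡ-≤; +-suc; +-identityʳ; 1+n≰n; m^n>0)
open import Data.Product.Base using (∃-syntax; _×_; _,_; proj₁; proj₂)
open import Data.Sum.Base using (inj₁; inj₂)
open import Level using (Level)
open import Relation.Binary.Bundles using (Setoid)
open import Relation.Binary.Core using (Rel)
open import Relation.Binary.PropositionalEquality using (_≡_; refl; sym; trans; cong; subst)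
open import Relation.Nullary.Decidable using (yes; no; decidable-stable; ¬¬-excluded-middle)
open import Relation.Nullary.Negation using (¬_)
open import Relation.Unary using (Pred; _∈_; _∉_; _∪_; _≬_) renaming (_⊆_ to _⊆ᵖ_)

AllPairs-resp-⊆ : ∀ {a r} {A : Set a} {R : Rel A r} {xs ys : List A} →
                  xs ⊆ ys → AllPairs R ys → AllPairs R xs
AllPairs-resp-⊆ []           []       = []
AllPairs-resp-⊆ (_ ∷ʳ xs⊆)   (_ ∷ rs) = AllPairs-resp-⊆ xs⊆ rs
AllPairs-resp-⊆ (refl ∷ xs⊆) (r ∷ rs) = All-resp-⊆ xs⊆ r ∷ AllPairs-resp-⊆ xs⊆ rs

module _ {c ℓ : Level} (S : Setoid c ℓ) where

  open Setoid S using (Carrier; _≈_)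
  open Cardinality S

  private variable
    p q : Level
    P : Pred Carrier p
    Q : Pred Carrier q

  atMost-mono : ∀ {j k} → P ⊆ᵖ Q → j ≤ k → AtMost Q j → AtMost P k
  atMost-mono P⊆Q j≤k atMost xs u ps = ≤-trans (atMost xs u (All.map P⊆Q ps)) j≤k

  atMost-stable : ∀ {k} → ¬ ¬ AtMost P k → AtMost P k
  atMost-stable {k = k} ¬¬atMost xs u ps =
    decidable-stable (length xs ≤? k) λ ≰k → ¬¬atMost λ atMost → ≰k (atMost xs u ps)

  -- Distinctness of list entries is a negation, so equality up to double negation already refutes a
  -- list of two.
  atMost-1 : (∀ {x y} → x ∈ P → y ∈ P → ¬ ¬ x ≈ y) → AtMost P 1
  atMost-1 eq []          _               _             = z≤n
  atMost-1 eq (_ ∷ [])    _               _             = ≤-refl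
  atMost-1 eq (_ ∷ _ ∷ _) ((x≉y ∷ _) ∷ _) (px ∷ py ∷ _) = ⊥-elim (eq px py x≉y)

  private
    split : ∀ {xs} → All (P ∪ Q) xs →
            ∃[ ys ] ∃[ zs ] ys ⊆ xs × zs ⊆ xs × All P ys × All Q zs × length xs ≡ length ys + length zs
    split [] = [] , [] , [] , [] , [] , [] , refl
    split (pq ∷ pqs) with split pqs
    split (inj₁ p ∷ _) | ys , zs , ys⊆ , zs⊆ , ps , qs , eq =
      _ ∷ ys , zs , refl ∷ ys⊆ , _ ∷ʳ zs⊆ , p ∷ ps , qs , cong suc eq
    split (inj₂ q ∷ _) | ys , zs , ys⊆ , zs⊆ , ps , qs , eq =
      ys , _ ∷ zs , _ ∷ʳ ys⊆ , refl ∷ zs⊆ , ps , q ∷ qs ,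
      trans (cong suc eq) (sym (+-suc (length ys) (length zs)))

  atMost-∪ : ∀ {j k} → AtMost P j → AtMost Q k → AtMost (P ∪ Q) (j + k)
  atMost-∪ atMostP atMostQ xs u pqs with split pqs
  ... | ys , zs , ys⊆ , zs⊆ , ps , qs , eq =
    ≤-trans (≤-reflexive eq)
      (+-mono-≤ (atMostP ys (AllPairs-resp-⊆ ys⊆ u) ps) (atMostQ zs (AllPairs-resp-⊆ zs⊆ u) qs))

  atMost-Any : ∀ {i k} {I : Set i} {R : I → Pred Carrier p} {is : List I} →
               All (λ i → AtMost (R i) k) is →
               AtMost (λ x → Any (λ i → x ∈ R i) is) (length is * k)
  atMost-Any []                 []      _ _        = z≤n
  atMost-Any []                 (_ ∷ _) _ (() ∷ _)
  atMost-Any (atMost ∷ atMosts) =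
    atMost-mono (λ { (here r) → inj₁ r ; (there rs) → inj₂ rs }) ≤-refl
      (atMost-∪ atMost (atMost-Any atMosts))

-- Double negation can be pulled out of a finite conjunction, one entry at a time.
¬¬-all : ∀ {a p} {A : Set a} {P : Pred A p} {xs : List A} →
         All (λ x → ¬ ¬ P x) xs → ¬ ¬ All P xs
¬¬-all []           ¬all = ¬all []
¬¬-all (¬¬px ∷ pxs) ¬all = ¬¬px λ px → ¬¬-all pxs λ pxs → ¬all (px ∷ pxs)

module _ {v : Level} (V : Set v) where

  open EdgeCardinality V

  -- Finiteness of `P` turns the quantifier over its members into one over a list, where `¬¬-all`
  -- applies.
  hasSize⇒¬¬⊆ : ∀ {p q k} {P : Pred V p} {Q : Pred V q} → HasSize P k →
                (∀ {x} → x ∈ P → ¬ ¬ x ∈ Q) → ¬ ¬ (P ⊆ᵖ Q)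
  hasSize⇒¬¬⊆ (_ , _ , ps , complete , _) P⊆¬¬Q ¬P⊆Q =
    ¬¬-all (All.map P⊆¬¬Q ps) λ qs → ¬P⊆Q λ x∈P → All.lookup qs (complete x∈P)

module MinimalTransversals
  {v ℓ ℓ′ : Level} {V : Set v} (A B : Pred (Edge ℓ V) ℓ′) (n : ℕ)
  (transversal : ∀ {a b} → a ∈ A → b ∈ B → a ≬ b)
  (minimal : ∀ {a} → a ∈ A → ∀ {x} → x ∈ a → ∃[ b ] b ∈ B × (∀ {y} → y ∈ a → y ∈ b → x ≡ y))
  (A-bounded : ∀ {a} → a ∈ A → ∃[ k ] EdgeCardinality.HasSize V a k × k ≤ n)
  (B-bounded : ∀ {b} → b ∈ B → ∃[ k ] EdgeCardinality.HasSize V b k × k ≤ n)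
  where

  open EdgeCardinality V using (hasSize⇒atMost)
  open FamilyCardinality V ℓ using (AtMost)
  open import Data.List.Relation.Unary.Unique.Propositional using (Unique)
  open import Relation.Unary.Relation.Binary.Equality using (≐-setoid)

  Containing : List V → Pred (Edge ℓ V) _
  Containing S a = a ∈ A × All (_∈ a) S

  Misses : List V → Pred (Edge ℓ V) _
  Misses S b = b ∈ B × All (_∉ b) S

  -- Let `a` and `a′` both contain `S`, and suppose that `x` lies in `a` but not in `a′`. Minimality
  -- gives an edge `b` meeting `a` only in `x`. A vertex of `S` in `b` would equal `x` and so put
  -- `x` into `a′`; hence `b` misses `S`, which is excluded.
  containing-atMost-1 : ∀ {S} → ¬ (∃[ b ] Misses S b) → AtMost (Containing S) 1
  containing-atMost-1 {S} meets = atMost-1 (≐-setoid V ℓ) λ a∈ a′∈ a≉a′ →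
    ⊆-¬¬ a∈ a′∈ λ a⊆a′ → ⊆-¬¬ a′∈ a∈ λ a′⊆a → a≉a′ (a⊆a′ , a′⊆a)
    where
    ⊆-¬¬ : ∀ {a a′} → a ∈ Containing S → a′ ∈ Containing S → ¬ ¬ (a ⊆ᵖ a′)
    ⊆-¬¬ {a} {a′} (a∈A , S⊆a) (_ , S⊆a′) =
      hasSize⇒¬¬⊆ V (proj₁ (proj₂ (A-bounded a∈A))) λ x∈a x∉a′ →
        let b , b∈B , only = minimal a∈A x∈a
        in meets (b , b∈B , All.zipWith
             (λ (s∈a , s∈a′) s∈b → x∉a′ (subst a′ (sym (only s∈a s∈b)) s∈a′))
             (S⊆a , S⊆a′))

  unique-∷ : ∀ {S x} {b : Edge ℓ V} → Unique S → All (_∉ b) S → x ∈ b → Unique (x ∷ S)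
  unique-∷ u S∉b x∈b = All.map (λ { s∉b refl → s∉b x∈b }) S∉b ∷ u

  -- The exponent `d` is the number of vertices that `S` can still gain before reaching size `n`; it
  -- drops by one with each branching.
  containing-atMost : ∀ d {S} → Unique S → length S + d ≡ n → AtMost (Containing S) (n ^ d)
  branch : ∀ d {S b} → Unique S → length S + d ≡ n → Misses S b → AtMost (Containing S) (n ^ d)

  containing-atMost d {S} u eq =
    atMost-stable (≐-setoid V ℓ) λ ¬atMost → ¬¬-excluded-middle {A = ∃[ b ] Misses S b} λ where
      (yes (_ , missed)) → ¬atMost (branch d u eq missed)
      (no meets)         → ¬atMost (atMost-mono (≐-setoid V ℓ) (λ a∈ → a∈) (1≤n^d d eq)
                             (containing-atMost-1 meets))
    where
    1≤n^d : ∀ d → length S + d ≡ n → 1 ≤ n ^ d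
    1≤n^d zero    _  = ≤-refl
    -- A positive `d` forces `n` to be a successor, so its power is positive; for `d = 0` even
    -- `0 ^ 0` is 1.
    1≤n^d (suc d) eq with refl ← trans (sym eq) (+-suc (length S) d) = m^n>0 n (suc d)

  -- Here `S` already has `n` vertices, so no edge of `A` contains it: a common vertex with `b`
  -- would be a further one. The class is empty and the bound `n ^ 0` holds vacuously.
  branch zero u eq (b∈B , S∉b) = atMost-1 (≐-setoid V ℓ) λ (a∈A , S⊆a) _ _ →
    let _ , x∈a , x∈b = transversal a∈A b∈B
        _ , size , k≤n = A-bounded a∈A
    in 1+n≰n (subst (_ ≤_) (trans (sym eq) (+-identityʳ _))
         (hasSize⇒atMost size k≤n _ (unique-∷ u S∉b x∈b) (x∈a ∷ S⊆a)))
  branch (suc d) u eq (b∈B , S∉b) with B-bounded b∈B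
  ... | _ , (bs , _ , bs⊆b , complete , refl) , k≤n =
    -- The classes, one for each vertex of `b`, may overlap; a bound by the sum of their sizes is
    -- enough.
    atMost-mono (≐-setoid V ℓ)
      (λ (a∈A , S⊆a) →
        let _ , x∈a , x∈b = transversal a∈A b∈B
        in Any.map (λ { refl → a∈A , x∈a ∷ S⊆a }) (complete x∈b))
      (*-monoˡ-≤ (n ^ d) k≤n)
      (atMost-Any (≐-setoid V ℓ)
        (All.map (λ x∈b → containing-atMost d (unique-∷ u S∉b x∈b) (trans (sym (+-suc _ d)) eq)) bs⊆b))

  A-atMost : AtMost A (n ^ n)
  A-atMost = atMost-mono (≐-setoid V ℓ) (λ a∈A → a∈A , []) ≤-refl (containing-atMost n [] refl)

theorem1p10 : {v ℓ ℓ′ : Level} {V : Set v} (H : CrossIntersectingFamily V ℓ ℓ′) →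
    let open CrossIntersectingFamily H
        open FamilyCardinality V ℓ
    in Critical H → (n : ℕ) → IsMaxEdgeSize H n →
       AtMost A (n ^ n) × AtMost B (n ^ n)
theorem1p10 H critical n maxSize =
  MinimalTransversals.A-atMost A B n
    cross-intersecting
    (λ a∈A x∈a → let b , b∈B , a∩b⊆ , _ = critical-A a∈A x∈a
                 in b , b∈B , λ y∈a y∈b → a∩b⊆ (y∈a , y∈b))
    (λ a∈A → bounded (inj₁ a∈A)) (λ b∈B → bounded (inj₂ b∈B)) ,
  -- Criticality is symmetric, so edges of `B` are minimal transversals of `A`.
  MinimalTransversals.A-atMost B A n
    (λ b∈B a∈A → let x , x∈a , x∈b = cross-intersecting a∈A b∈B in x , x∈b , x∈a)
    (λ b∈B x∈b → let a , a∈A , a∩b⊆ , _ = critical-B b∈B x∈b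
                 in a , a∈A , λ y∈b y∈a → a∩b⊆ (y∈a , y∈b))
    (λ b∈B → bounded (inj₂ b∈B)) (λ a∈A → bounded (inj₁ a∈A))
  where
  open CrossIntersectingFamily H
  open Critical critical
  open IsMaxEdgeSize maxSize
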